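{- Let $n\ge 3$, $1\le t<n$, and let $c_1,c_2,\ldots,c_t\in[n]$ be distinct integers such that the sequence $(c_1,\ldots,c_t)$ avoids the pattern $123$. If $c_i<c_j$ for some $1\le i<j\le t$ and there exists $\alpha\in[n]$ with $\alpha>c_j$ and $\alpha\notin\{c_1,\ldots,c_t\}$ (for that same $j$), then $|S_{n,(c_1,\ldots,c_t)}(123)|=0$; otherwise, $$|S_{n,(c_1,\ldots,c_t)}(123)|=|S_{n-t+1,\min\{c_1,\ldots,c_t\}}(123)|=b_{n-t+1,\min\{c_1,\ldots,c_t\}},$$ where $b_{m,r}=\frac{m-r+1}{m+r-1}\binom{m+r-1}{m}$ for $1\le r\le m$.
   Context: $[n]=\{1,\ldots,n\}$ and $S_n$ is the set of permutations of $[n]$ written as sequences $(\tau(1),\ldots,\tau(n))$. A sequence of distinct integers $\tau=(\tau(1),\ldots,\tau(m))$ contains $\sigma\in S_k$ as a pattern if there are indices $1\le i_1<\cdots<i_k\le m$ such that for all $1\le a<b\le k$, $\tau(i_a)<\tau(i_b)$ if and only if $\sigma(a)<\sigma(b)$; otherwise $\tau$ avoids $\sigma$. $S_{n,(c_1,\ldots,c_t)}(\sigma)$ is the set of $\tau\in S_n$ with $(\tau(1),\ldots,\tau(t))=(c_1,\ldots,c_t)$ that avoid $\sigma$. For $1\le r\le m$, $S_{m,r}(\sigma)$ is the set of $\tau\in S_m$ with $\tau(1)=r$ that avoid $\sigma$. -}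

module Defs where

open import Data.Nat using (ℕ; zero; suc; _+_; _∸_; _≤_; _<_)
open import Data.Nat.Combinatorics using (_C_)
open import Data.Fin as Fin using (Fin)
open import Data.Integer using (+_)
open import Data.Rational as ℚ using (ℚ; 0ℚ)
open import Data.List using (List; []; _∷_; length; lookup; take; head; applyUpTo)
open import Data.List.Extrema.Nat using (min)
open import Data.List.Membership.Propositional using (_∈_; _∉_)
open import Data.List.Relation.Unary.Unique.Propositional using (Unique)
open import Data.List.Relation.Binary.Permutation.Propositional using (_↭_)
open import Data.Maybe using (just)
open import Data.Product using (Σ-syntax; ∃-syntax; _×_)
open import Function.Bundles using (_⇔_)
open import Relation.Nullary using (¬_)
open import Relation.Binary.PropositionalEquality using (_≡_)

-- Elements are compared by _≡_ and membership may have many proofs, so a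
-- cardinality is witnessed by a duplicate-free enumeration of the predicate
-- rather than by a bijection with the type Σ A P.
record HasCard {A : Set} (P : A → Set) (k : ℕ) : Set where
  field
    elements : List A
    unique   : Unique elements
    complete : ∀ x → (x ∈ elements) ⇔ P x
    size     : length elements ≡ k

⟦_⟧ : ℕ → List ℕ
⟦ n ⟧ = applyUpTo suc n

-- Permutations of [n] in one-line notation (τ(1), …, τ(n)).
Perm : ℕ → List ℕ → Set
Perm n τ = τ ↭ ⟦ n ⟧

Contains : List ℕ → List ℕ → Set
Contains τ σ =
  Σ[ i ∈ (Fin (length σ) → Fin (length τ)) ]
    ((∀ a b → a Fin.< b → i a Fin.< i b) ×
     (∀ a b → a Fin.< b →
        (lookup τ (i a) < lookup τ (i b)) ⇔ (lookup σ a < lookup σ b)))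

Avoids : List ℕ → List ℕ → Set
Avoids τ σ = ¬ Contains τ σ

-- S n c σ is S_{n,(c₁,…,c_t)}(σ) with t = length c.
S : ℕ → List ℕ → List ℕ → List ℕ → Set
S n c σ τ = Perm n τ × take (length c) τ ≡ c × Avoids τ σ

-- S₁ m r σ is S_{m,r}(σ).
S₁ : ℕ → ℕ → List ℕ → List ℕ → Set
S₁ m r σ τ = Perm m τ × head τ ≡ just r × Avoids τ σ

p123 : List ℕ
p123 = 1 ∷ 2 ∷ 3 ∷ []

AscentBelowMissing : ℕ → List ℕ → Set
AscentBelowMissing n c =
  ∃[ i ] ∃[ j ] (i Fin.< j × lookup c i < lookup c j ×
    ∃[ α ] (α ∈ ⟦ n ⟧ × lookup c j < α × α ∉ c))

-- The library's min takes a value for the empty list, which also bounds the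
-- result; for a nonempty c with entries in [n], the bound n has no effect.
minOf : ℕ → List ℕ → ℕ
minOf n c = min n c

-- Division by zero is given the value 0; it does not occur in b m r when
-- 1 ≤ r ≤ m.
_÷_ : ℕ → ℕ → ℚ
p ÷ zero    = 0ℚ
p ÷ (suc q) = + p ℚ./ suc q

-- Meant for 1 ≤ r ≤ m, where no truncation takes place in ∸.
b : ℕ → ℕ → ℚ
b m r = ((m ∸ r + 1) ÷ (m + r ∸ 1)) ℚ.* (((m + r ∸ 1) C m) ÷ 1)

{-# OPTIONS --safe #-}

-- Write τ = c w. If no ascent of c lies below a missing value, then τ avoids 123 exactly when w
-- does and no element of c is below an ascent of w; for the latter only r = min c matters.
-- When l missing values are below r and u above it, the first letter of w is either the maximum of
-- the upper ones, which then constrains nothing, or one of the lower ones, which becomes the new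
-- minimum. So the count depends only on (l , u), and splitting the second case by whether the
-- letter is the largest of the lower values yields the ballot recursion.
module Submission where

open import Defs
open import Data.Nat using (ℕ; zero; suc; _+_; _*_; _∸_; _≤_; _<_; _>_; _≮_; z<s; s<s; s≤s; _<?_; _≟_)
open import Data.Nat.Properties hiding (_<?_; _≟_)
open import Data.Nat.Combinatorics using (_C_; nCk≡nC[n∸k]; nCk+nC[k+1]≡[n+1]C[k+1]; nC1≡n)
open import Data.Nat.Tactic.RingSolver using (solve-∀)
import Data.Integer as ℤ
import Data.Integer.Properties as ℤₚ
import Data.Rational as ℚ
import Data.Rational.Properties as ℚₚ
open import Data.Rational.Unnormalised as ℚᵘ using (mkℚᵘ; *≡*)
import Data.Rational.Unnormalised.Properties as ℚᵘₚ
open import Data.Fin as Fin using (Fin; zero; suc)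
import Data.Fin.Properties as Finₚ
open import Data.List using (List; []; _∷_; _++_; length; lookup; take; drop; map; filter; applyDownFrom)
open import Data.List.Extrema.Nat using (argmin-sel; min≤xs)
open import Data.List.Properties
  using (++-assoc; length-++; length-map; ∷-injectiveˡ; ∷-injectiveʳ; ++-cancelˡ; take++drop≡id;
         length-applyUpTo; length-applyDownFrom)
open import Data.List.Relation.Unary.All as All using (All; []; _∷_)
import Data.List.Relation.Unary.All.Properties as Allₚ
open import Data.List.Relation.Unary.Any as Any using (here; there)
open import Data.List.Relation.Unary.Any.Properties using (lookup-index)
open import Data.List.Relation.Unary.AllPairs as AllPairs using (AllPairs; []; _∷_)
import Data.List.Relation.Unary.AllPairs.Properties as AllPairsₚ
open import Data.List.Relation.Unary.Unique.Propositional using (Unique)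
import Data.List.Relation.Unary.Unique.Propositional.Properties as Uniqueₚ
open import Data.List.Membership.Propositional using (_∈_; _∉_)
open import Data.List.Membership.DecPropositional _≟_ using (_∈?_)
open import Data.List.Membership.Propositional.Properties
  using (∈-++⁺ˡ; ∈-++⁺ʳ; ∈-++⁻; ∈-map⁺; ∈-map⁻; ∈-lookup; ∈-filter⁺; ∈-filter⁻;
         ∈-applyUpTo⁺; ∈-applyUpTo⁻; ∈-applyDownFrom⁺; ∈-applyDownFrom⁻)
open import Data.List.Membership.Propositional.Properties.WithK using (unique∧set⇒bag)
open import Data.List.Relation.Binary.BagAndSetEquality using (∼bag⇒↭)
open import Data.List.Relation.Binary.Permutation.Propositional
  using (_↭_; ↭-refl; ↭-sym; ↭-trans; ↭-prep; ↭-reflexive)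
open import Data.List.Relation.Binary.Permutation.Propositional.Properties
  using (∈-resp-↭; ↭-length; shift; drop-∷; ¬x∷xs↭[]; ↭-empty-inv; ++⁺ˡ)
open import Data.Maybe using (just)
open import Data.Maybe.Properties using (just-injective)
open import Data.Product using (_×_; _,_; ∃-syntax; proj₁; proj₂)
open import Data.Sum as Sum using (_⊎_; inj₁; inj₂; [_,_]′)
open import Data.Empty using (⊥-elim)
open import Function using (_∘_; id)
open import Function.Bundles using (_⇔_; mk⇔; Equivalence)
import Function.Properties.Equivalence as ⇔
open import Relation.Binary.Definitions using (Transitive; tri<; tri≈; tri>)
open import Relation.Binary.PropositionalEquality
open import Relation.Nullary using (¬_; yes; no; ¬?; _×-dec_)

-- Ballot numbers

-- Catalan's triangle, with the Catalan numbers as `ballot l 0`. The arguments count the remaining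
-- values below and above the prefix minimum.
ballot : ℕ → ℕ → ℕ
ballot zero    u       = 1
ballot (suc l) zero    = ballot l 1
ballot (suc l) (suc u) = ballot (suc l) u + ballot l (2 + u)

-- Equality of normalised rationals is reduced to cross-multiplication by passing to unnormalised
-- ones.
÷-*-÷ : ∀ k p q c → suc q * k ≡ p * c → k ÷ 1 ≡ (p ÷ suc q) ℚ.* (c ÷ 1)
÷-*-÷ k p q c eq = ℚₚ.toℚᵘ-injective (begin
  ℚ.toℚᵘ (k ÷ 1)                              ≈⟨ ℚₚ.toℚᵘ-fromℚᵘ (mkℚᵘ (ℤ.+ k) 0) ⟩
  mkℚᵘ (ℤ.+ k) 0                                ≈⟨ *≡* cross ⟩
  mkℚᵘ (ℤ.+ p) q ℚᵘ.* mkℚᵘ (ℤ.+ c) 0              ≈⟨ ℚᵘₚ.*-cong (ℚₚ.toℚᵘ-fromℚᵘ (mkℚᵘ (ℤ.+ p) q)) (ℚₚ.toℚᵘ-fromℚᵘ (mkℚᵘ (ℤ.+ c) 0)) ⟨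
  ℚ.toℚᵘ (p ÷ suc q) ℚᵘ.* ℚ.toℚᵘ (c ÷ 1)      ≈⟨ ℚₚ.toℚᵘ-homo-* (p ÷ suc q) (c ÷ 1) ⟨
  ℚ.toℚᵘ ((p ÷ suc q) ℚ.* (c ÷ 1))            ∎)
  where
  open ℚᵘₚ.≃-Reasoning
  cross : ℤ.+ k ℤ.* ℤ.+ (suc q * 1) ≡ (ℤ.+ p ℤ.* ℤ.+ c) ℤ.* ℤ.+ 1
  cross rewrite *-identityʳ (suc q) | ℤₚ.*-identityʳ (ℤ.+ p ℤ.* ℤ.+ c) =
    trans (sym (ℤₚ.pos-* k (suc q))) (trans (cong ℤ.+_ (trans (*-comm k (suc q)) eq)) (ℤₚ.pos-* p c))

open ≡-Reasoning

pascal : ∀ n k → suc n C suc k ≡ n C k + n C suc k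
pascal n k = sym (nCk+nC[k+1]≡[n+1]C[k+1] n k)

central-C : ∀ l → (1 + l + l) C l ≡ (1 + l + l) C suc l
central-C l = begin
  (1 + l + l) C l               ≡⟨ nCk≡nC[n∸k] (m≤n+m l (suc l)) ⟩
  (1 + l + l) C (1 + l + l ∸ l) ≡⟨ cong ((1 + l + l) C_) (m+n∸n≡m (suc l) l) ⟩
  (1 + l + l) C suc l           ∎

absorption : ∀ n k → suc k * (suc n C suc k) ≡ suc n * (n C k)
absorption zero    zero    = refl
absorption zero    (suc k) = *-zeroʳ (2 + k)
absorption (suc n) zero    = begin
  1 * (suc (suc n) C 1)     ≡⟨ *-identityˡ _ ⟩
  suc (suc n) C 1           ≡⟨ nC1≡n (2 + n) ⟩
  2 + n               ≡⟨ *-identityʳ _ ⟨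
  (2 + n) * 1         ∎
absorption (suc n) (suc k) = begin
  (2 + k) * (suc (suc n) C (2 + k))                     ≡⟨ cong ((2 + k) *_) (pascal (suc n) (suc k)) ⟩
  (2 + k) * (x + (suc n C (2 + k)))                ≡⟨ split (suc k) x (suc n C (2 + k)) ⟩
  suc k * x + x + (2 + k) * (suc n C (2 + k))     ≡⟨ cong₂ (λ y z → y + x + z) (absorption n k) (absorption n (suc k)) ⟩
  suc n * (n C k) + x + suc n * (n C suc k)       ≡⟨ gather (suc n) (n C k) (n C suc k) x ⟩
  suc n * (n C k + n C suc k) + x                 ≡⟨ cong (λ y → suc n * y + x) (pascal n k) ⟨
  suc n * x + x                                   ≡⟨ +-comm (suc n * x) x ⟩
  (2 + n) * x                                     ∎
  where
  x = suc n C suc k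
  split : ∀ k x y → suc k * (x + y) ≡ k * x + x + suc k * y
  split = solve-∀
  gather : ∀ n a b x → n * a + x + n * b ≡ n * (a + b) + x
  gather = solve-∀

-- The reflection principle for ballot sequences, with the subtraction moved to the left-hand side.
ballot-reflection : ∀ l u {n} → n ≡ 2 + (l + l) + u →
                    ballot (suc l) u + n C l ≡ n C suc l
ballot-reflection zero    zero    refl = refl
ballot-reflection zero    (suc u) {n} refl = begin
  ballot 1 u + 1 + 1  ≡⟨ cong (_+ 1) (ballot-reflection zero u refl) ⟩
  (2 + u) C 1 + 1     ≡⟨ cong (_+ 1) (nC1≡n (2 + u)) ⟩
  2 + u + 1           ≡⟨ +-comm (2 + u) 1 ⟩
  3 + u               ≡⟨ nC1≡n (3 + u) ⟨
  (3 + u) C 1         ∎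
-- At `u = 0` the recursion has a single summand. Here `n` is odd, and the equality of its two
-- middle binomial coefficients supplies the other half of Pascal's rule.
ballot-reflection (suc l) zero    {suc n} eq = begin
  ballot (suc l) 1 + suc n C suc l               ≡⟨ cong (ballot (suc l) 1 +_) (pascal n l) ⟩
  ballot (suc l) 1 + (n C l + n C suc l)         ≡⟨ +-assoc (ballot (suc l) 1) (n C l) (n C suc l) ⟨
  ballot (suc l) 1 + n C l + n C suc l           ≡⟨ cong (_+ n C suc l) (ballot-reflection l 1 (trans n≡ (odd l))) ⟩
  n C suc l + n C suc l                          ≡⟨ cong (n C suc l +_) central ⟩
  n C suc l + n C suc (suc l)                    ≡⟨ pascal n (suc l) ⟨
  suc n C suc (suc l)                            ∎
  where
  odd : ∀ l → suc (suc l + suc l) ≡ 2 + (l + l) + 1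
  odd = solve-∀
  n≡ : n ≡ suc (suc l + suc l)
  n≡ = trans (suc-injective eq) (+-identityʳ _)
  central : n C suc l ≡ n C suc (suc l)
  central = subst (λ n → n C suc l ≡ n C suc (suc l)) (sym n≡) (central-C (suc l))
ballot-reflection (suc l) (suc u) {suc n} eq = begin
  x + y + suc n C suc l                ≡⟨ cong (x + y +_) (pascal n l) ⟩
  x + y + (n C l + n C suc l)          ≡⟨ regroup x y (n C l) (n C suc l) ⟩
  (y + n C l) + (x + n C suc l)        ≡⟨ cong₂ _+_ (ballot-reflection l (2 + u) (trans n≡ (reindex l u)))
                                                    (ballot-reflection (suc l) u n≡) ⟩
  n C suc l + n C suc (suc l)          ≡⟨ pascal n (suc l) ⟨
  suc n C suc (suc l)                  ∎
  where
  x = ballot (suc (suc l)) u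
  y = ballot (suc l) (2 + u)
  n≡ : n ≡ 2 + (suc l + suc l) + u
  n≡ = trans (suc-injective eq) (+-suc _ u)
  reindex : ∀ l u → 2 + (suc l + suc l) + u ≡ 2 + (l + l) + (2 + u)
  reindex = solve-∀
  regroup : ∀ x y a b → x + y + (a + b) ≡ (y + a) + (x + b)
  regroup = solve-∀

-- Absorption turns the difference of binomial coefficients given by reflection into a single
-- multiple of one coefficient.
ballot-closed : ∀ l u {n} → n ≡ suc (l + l + u) → n * ballot l u ≡ suc u * (n C l)
ballot-closed zero    u refl = refl
-- By absorption the added term is `2 * (suc n * (n C l))`: one copy of `n C l` feeds the reflection
-- identity, the other completes Pascal's rule.
ballot-closed (suc l) u {suc n} eq = +-cancelʳ-≡ (2 * (suc l * c)) _ _ (begin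
  suc n * y + 2 * (suc l * c)                ≡⟨ cong (λ z → suc n * y + 2 * z) (absorption n l) ⟩
  suc n * y + 2 * (suc n * (n C l))          ≡⟨ expand (suc n) y (n C l) ⟩
  suc n * (n C l + (y + n C l))              ≡⟨ cong (λ z → suc n * (n C l + z)) (ballot-reflection l u n≡) ⟩
  suc n * (n C l + n C suc l)                ≡⟨ cong (suc n *_) (pascal n l) ⟨
  suc n * c                                  ≡⟨ cong (λ n → suc n * c) n≡ ⟩
  suc (2 + (l + l) + u) * c                  ≡⟨ collect l u c ⟩
  suc u * c + 2 * (suc l * c)                ∎)
  where
  c = suc n C suc l
  y = ballot (suc l) u
  n≡ : n ≡ 2 + (l + l) + u
  n≡ = trans (suc-injective eq) (cong (λ m → suc (m + u)) (+-suc l l))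
  expand : ∀ n y a → n * y + 2 * (n * a) ≡ n * (a + (y + a))
  expand = solve-∀
  collect : ∀ l u c → suc (2 + (l + l) + u) * c ≡ suc u * c + 2 * (suc l * c)
  collect = solve-∀

-- With `m = l + u + 1` and `r = l + 1`, the numerator of `b` is `u + 1` and its denominator is
-- `m + l`; symmetry exchanges the lower indices `l` and `m`.
ballot-b : ∀ l u → ballot l u ÷ 1 ≡ b (suc (l + u)) (suc l)
ballot-b l u
  rewrite m+n∸m≡n l u | +-suc (l + u) l | +-comm u 1
  = ÷-*-÷ (ballot l u) (suc u) (l + u + l) (suc (l + u + l) C suc (l + u))
      (trans (ballot-closed l u n≡) (cong (suc u *_) symmetric))
  where
  n≡ : suc (l + u + l) ≡ suc (l + l + u)
  n≡ = cong suc (trans (+-assoc l u l) (trans (cong (l +_) (+-comm u l)) (sym (+-assoc l l u))))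
  symmetric : suc (l + u + l) C l ≡ suc (l + u + l) C suc (l + u)
  symmetric = trans (nCk≡nC[n∸k] (m≤n+m l (suc (l + u))))
                    (cong (suc (l + u + l) C_) (m+n∸n≡m (suc (l + u)) l))

-- Finite cardinalities

module _ {A : Set} where

  HasCard-∅ : {P : A → Set} → (∀ x → ¬ P x) → HasCard P 0
  HasCard-∅ ¬P = record
    { elements = []
    ; unique   = []
    ; complete = λ x → mk⇔ (λ ()) (⊥-elim ∘ ¬P x)
    ; size     = refl
    }

  HasCard-singleton : (a : A) → HasCard (_≡ a) 1
  HasCard-singleton a = record
    { elements = a ∷ []
    ; unique   = [] ∷ []
    ; complete = λ x → mk⇔ (λ { (here eq) → eq ; (there ()) }) here
    ; size     = refl
    }

  HasCard-resp-⇔ : ∀ {P Q : A → Set} {k} → (∀ x → P x ⇔ Q x) → HasCard P k → HasCard Q k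
  HasCard-resp-⇔ P⇔Q h = record
    { elements = elements
    ; unique   = unique
    ; complete = λ x → mk⇔ (Equivalence.to (P⇔Q x) ∘ Equivalence.to (complete x))
                           (Equivalence.from (complete x) ∘ Equivalence.from (P⇔Q x))
    ; size     = size
    }
    where open HasCard h

  HasCard-⊎ : ∀ {P Q : A → Set} {j k} → (∀ {x} → P x → ¬ Q x) →
              HasCard P j → HasCard Q k → HasCard (λ x → P x ⊎ Q x) (j + k)
  HasCard-⊎ disjoint hP hQ = record
    { elements = P.elements ++ Q.elements
    ; unique   = Uniqueₚ.++⁺ P.unique Q.unique λ (x∈P , x∈Q) →
        disjoint (Equivalence.to (P.complete _) x∈P) (Equivalence.to (Q.complete _) x∈Q)
    ; complete = λ x → mk⇔
        (Sum.map (Equivalence.to (P.complete x)) (Equivalence.to (Q.complete x)) ∘ ∈-++⁻ P.elements)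
        [ ∈-++⁺ˡ ∘ Equivalence.from (P.complete x)
        , ∈-++⁺ʳ P.elements ∘ Equivalence.from (Q.complete x) ]′
    ; size     = trans (length-++ P.elements) (cong₂ _+_ P.size Q.size)
    }
    where
    module P = HasCard hP
    module Q = HasCard hQ

  HasCard-map : ∀ {B : Set} {P : A → Set} {k} (f : A → B) → (∀ {x y} → f x ≡ f y → x ≡ y) →
                HasCard P k → HasCard (λ y → ∃[ x ] (P x × y ≡ f x)) k
  HasCard-map f f-injective h = record
    { elements = map f elements
    ; unique   = Uniqueₚ.map⁺ f-injective unique
    ; complete = λ y → mk⇔
        (λ y∈ → let x , x∈ , y≡ = ∈-map⁻ f y∈ in x , Equivalence.to (complete x) x∈ , y≡)
        (λ { (x , Px , refl) → ∈-map⁺ f (Equivalence.from (complete x) Px) })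
    ; size     = trans (length-map f elements) size
    }
    where open HasCard h

-- Words after a prefix

NoAscentAbove : ℕ → List ℕ → Set
NoAscentAbove x = AllPairs (λ y z → x < y → y ≮ z)

-- Each letter is tested only as the `1` of a pattern, so prepending a letter adds a single
-- condition.
data Avoids123 : List ℕ → Set where
  []  : Avoids123 []
  _∷_ : ∀ {x τ} → NoAscentAbove x τ → Avoids123 τ → Avoids123 (x ∷ τ)

avoids-tail : ∀ {x τ} → Avoids123 (x ∷ τ) → Avoids123 τ
avoids-tail (_ ∷ av) = av

-- This is why only the minimum of a prefix matters: its condition implies that of every other
-- prefix letter.
noAscentAbove-mono : ∀ {x y τ} → x ≤ y → NoAscentAbove x τ → NoAscentAbove y τ
noAscentAbove-mono x≤y = AllPairs.map λ h y<z → h (≤-<-trans x≤y y<z)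

-- With U ++ r ∷ L strictly decreasing, these are the continuations of a prefix with minimum r
-- when the values L and U remain.
Word : List ℕ → ℕ → List ℕ → List ℕ → Set
Word U r L w = w ↭ U ++ L × Avoids123 (r ∷ w)

-- No prefix minimum is recorded: the first letter `x` is to become the new one, and its own
-- condition is already part of `Avoids123 w`.
DescentWord : List ℕ → List ℕ → List ℕ → Set
DescentWord V L w = ∃[ x ] ∃[ w′ ] (w ≡ x ∷ w′ × x ∈ L × w ↭ V ++ L × Avoids123 w)

Decreasing : List ℕ → Set
Decreasing = AllPairs _>_

module _ {R : ℕ → ℕ → Set} where

  allPairs-++⁻ : ∀ xs {ys} → AllPairs R (xs ++ ys) →
                 AllPairs R xs × AllPairs R ys × All (λ x → All (R x) ys) xs
  allPairs-++⁻ []       Rys        = [] , Rys , []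
  allPairs-++⁻ (x ∷ xs) (Rx ∷ Rxs) =
    let Rxs′ , Rys , Rxsys = allPairs-++⁻ xs Rxs
    in Allₚ.++⁻ˡ xs Rx ∷ Rxs′ , Rys , Allₚ.++⁻ʳ xs Rx ∷ Rxsys

  allPairs-drop-mid : ∀ xs {y ys} → AllPairs R (xs ++ y ∷ ys) → AllPairs R (xs ++ ys)
  allPairs-drop-mid []       (_ ∷ Rys)  = Rys
  allPairs-drop-mid (x ∷ xs) (Rx ∷ Rxs) =
    Allₚ.++⁺ (Allₚ.++⁻ˡ xs Rx) (All.tail (Allₚ.++⁻ʳ xs Rx)) ∷ allPairs-drop-mid xs Rxs

-- The maximum `v` in front of `w` has no larger letter after it, so it can be neither the `1` nor
-- the `2` of a pattern.
word-cons : ∀ {v U r L w} → Decreasing (v ∷ U ++ r ∷ L) → Word U r L w → Word (v ∷ U) r L (v ∷ w)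
word-cons {v} {U} {r} {L} {w} (v> ∷ _) (w↭ , noAscent ∷ av) =
  ↭-prep v w↭ , (All.map (λ v>y _ v<y → <-asym v>y v<y) w<v ∷ noAscent) ∷ noneAbove w<v ∷ av
  where
  w<v : All (v >_) w
  w<v = All.tabulate λ y∈w → All.lookup (Allₚ.++⁺ (Allₚ.++⁻ˡ U v>) (All.tail (Allₚ.++⁻ʳ U v>))) (∈-resp-↭ w↭ y∈w)
  noneAbove : ∀ {w} → All (v >_) w → NoAscentAbove v w
  noneAbove []            = []
  noneAbove (v>y ∷ v>w) = All.map (λ _ v<y → ⊥-elim (<-asym v>y v<y)) v>w ∷ noneAbove v>w

-- A first letter below `r` imposes a stronger condition on the rest than `r` does.
descentWord⇒word : ∀ U {r L w} → All (r >_) L → DescentWord U L w → Word U r L w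
descentWord⇒word _ r>L (x , w′ , refl , x∈L , w↭ , noAscent ∷ av) =
  w↭ , (All.tabulate (λ _ r<x → ⊥-elim (<-asym x<r r<x)) ∷
        AllPairs.map (λ h r<y → h (<-trans x<r r<y)) noAscent) ∷ noAscent ∷ av
  where x<r = All.lookup r>L x∈L

-- A first letter x in U other than its maximum v leaves v behind, giving the pattern r < x < v.
word-cases : ∀ {v U r L w} → Decreasing (v ∷ U ++ r ∷ L) → Word (v ∷ U) r L w →
             (∃[ w′ ] (Word U r L w′ × w ≡ v ∷ w′)) ⊎ DescentWord (v ∷ U) L w
word-cases {w = []} _ (w↭ , _) = ⊥-elim (¬x∷xs↭[] (↭-sym w↭))
word-cases {v} {U} {r} {L} {x ∷ w} (v> ∷ dec) (w↭ , (x≮ ∷ noAscent) ∷ av)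
  with ∈-resp-↭ w↭ (here refl)
... | here refl = inj₁ (w , (drop-∷ w↭ , noAscent ∷ avoids-tail av) , refl)
... | there x∈ with ∈-++⁻ U x∈
...   | inj₂ x∈L = inj₂ (x , w , refl , x∈L , w↭ , av)
...   | inj₁ x∈U with ∈-resp-↭ (↭-sym w↭) (here refl)
...     | here refl = ⊥-elim (<-irrefl refl (All.lookup v> (∈-++⁺ˡ x∈U)))
...     | there v∈w = ⊥-elim (All.lookup x≮ v∈w r<x (All.lookup v> (∈-++⁺ˡ x∈U)))
  where
  r<x : r < x
  r<x = All.head (All.lookup (proj₂ (proj₂ (allPairs-++⁻ U dec))) x∈U)

word-nil-cases : ∀ {r L w} → Word [] r L w → (L ≡ [] × w ≡ []) ⊎ DescentWord [] L w
word-nil-cases {w = []}    (w↭ , _)      = inj₁ (↭-empty-inv (↭-sym w↭) , refl)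
word-nil-cases {w = x ∷ w} (w↭ , _ ∷ av) = inj₂ (x , w , refl , ∈-resp-↭ w↭ (here refl) , w↭ , av)

snoc-cons-↭ : (V : List ℕ) (p : ℕ) (L : List ℕ) → (V ++ p ∷ []) ++ L ↭ V ++ p ∷ L
snoc-cons-↭ V p L = ↭-reflexive (++-assoc V (p ∷ []) L)

-- A first letter `p` takes the place of the minimum. Any other first letter leaves `p` to be placed
-- later, so `p` changes sides and joins `V`.
descentWord-cases : ∀ {V p L w} → DescentWord V (p ∷ L) w ⇔
  ((∃[ w′ ] (Word V p L w′ × w ≡ p ∷ w′)) ⊎ DescentWord (V ++ p ∷ []) L w)
descentWord-cases {V} {p} {L} = mk⇔
  (λ { (_ , w , refl , here refl , w↭ , av) →
         inj₁ (w , (drop-∷ (↭-trans w↭ (shift p V L)) , av) , refl)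
     ; (x , w , refl , there x∈L , w↭ , av) →
         inj₂ (x , w , refl , x∈L , ↭-trans w↭ (↭-sym (snoc-cons-↭ V p L)) , av) })
  (λ { (inj₁ (w , (w↭ , av) , refl)) →
         p , w , refl , here refl , ↭-trans (↭-prep p w↭) (↭-sym (shift p V L)) , av
     ; (inj₂ (x , w , refl , x∈L , w↭ , av)) →
         x , w , refl , there x∈L , ↭-trans w↭ (snoc-cons-↭ V p L) , av })

-- Induction on the first letter, mutual with the count of descent words. When both sides are
-- nonempty, the maximum of `U` and the descent words give the two summands of the recursion for
-- `ballot`.
word-count : ∀ U r L → Decreasing (U ++ r ∷ L) → HasCard (Word U r L) (ballot (length L) (length U))

-- For nonempty `L`, the first letter `p` contributes `ballot (length L) (length V)`; a smaller one
-- loses a lower value and gains the upper value `p`. Together these are the recursion at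
-- `suc (length V)`.
descentWord-count : ∀ V p L → Decreasing (V ++ p ∷ L) →
                    HasCard (DescentWord V (p ∷ L)) (ballot (length L) (suc (length V)))

word-count [] r [] dec = HasCard-resp-⇔
  (λ w → mk⇔ (λ { refl → ↭-refl , [] ∷ [] }) λ (w↭ , _) → ↭-empty-inv w↭)
  (HasCard-singleton [])
word-count [] r (p ∷ L) (r> ∷ dec) = HasCard-resp-⇔
  (λ w → mk⇔ (descentWord⇒word [] r>) ([ (λ ()) , id ]′ ∘ word-nil-cases))
  (descentWord-count [] p L dec)
word-count (v ∷ U) r [] dec@(_ ∷ dec′) = HasCard-resp-⇔
  (λ w → mk⇔ (λ { (w′ , W , refl) → word-cons dec W })
             ([ id , (λ ()) ]′ ∘ word-cases dec))
  (HasCard-map (v ∷_) ∷-injectiveʳ (word-count U r [] dec′))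
word-count (v ∷ U) r (p ∷ L) dec@(v> ∷ dec′) = HasCard-resp-⇔
  (λ w → mk⇔ [ (λ { (w′ , W , refl) → word-cons dec W }) , descentWord⇒word (v ∷ U) r> ]′ (word-cases dec))
  (HasCard-⊎ (λ { (_ , _ , refl) (_ , _ , refl , v∈ , _) → v∉ v∈ })
    (HasCard-map (v ∷_) ∷-injectiveʳ (word-count U r (p ∷ L) dec′))
    -- The old minimum `r` leaves the decreasing chain, and `p` becomes the value separating its two
    -- sides.
    (descentWord-count (v ∷ U) p L (allPairs-drop-mid (v ∷ U) dec)))
  where
  r> : All (r >_) (p ∷ L)
  r> = AllPairs.head (proj₁ (proj₂ (allPairs-++⁻ U dec′)))
  v∉ : v ∉ p ∷ L
  v∉ v∈ = <-irrefl refl (All.lookup v> (∈-++⁺ʳ U (there v∈)))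

descentWord-count V p [] dec = HasCard-resp-⇔
  (λ w → mk⇔ (Equivalence.from descentWord-cases ∘ inj₁)
             ([ id , (λ ()) ]′ ∘ Equivalence.to descentWord-cases))
  -- Since `ballot 0` is constantly 1, having `length V` instead of its successor as second argument
  -- makes no difference.
  (HasCard-map (p ∷_) ∷-injectiveʳ (word-count V p [] dec))
descentWord-count V p (q ∷ L) dec = HasCard-resp-⇔ (λ w → ⇔.sym descentWord-cases)
  (HasCard-⊎ (λ { (_ , _ , refl) (_ , _ , refl , p∈ , _) → <-irrefl refl (All.lookup p> p∈) })
    (HasCard-map (p ∷_) ∷-injectiveʳ (word-count V p (q ∷ L) dec))
    (subst (λ k → HasCard (DescentWord (V ++ p ∷ []) (q ∷ L)) (ballot (length L) (suc k)))
      (trans (length-++ V) (+-comm (length V) 1))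
      (descentWord-count (V ++ p ∷ []) q L (subst Decreasing (sym (++-assoc V (p ∷ []) (q ∷ L))) dec))))
  where
  p> : All (p >_) (q ∷ L)
  p> = AllPairs.head (proj₁ (proj₂ (allPairs-++⁻ V dec)))

-- Prefixes

module _ {R : ℕ → ℕ → Set} where

  allPairs-lookup : ∀ {xs} → AllPairs R xs → ∀ i j → i Fin.< j → R (lookup xs i) (lookup xs j)
  allPairs-lookup (Rx ∷ _)  zero    (suc j) _         = All.lookup Rx (∈-lookup j)
  allPairs-lookup (_ ∷ Rxs) (suc i) (suc j) (s<s i<j) = allPairs-lookup Rxs i j i<j

  allPairs-tabulate : ∀ xs → (∀ i j → i Fin.< j → R (lookup xs i) (lookup xs j)) → AllPairs R xs
  allPairs-tabulate []       h = []
  allPairs-tabulate (x ∷ xs) h =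
    All.tabulate (λ y∈xs → subst (R x) (sym (lookup-index y∈xs)) (h zero (suc (Any.index y∈xs)) z<s)) ∷
    allPairs-tabulate xs (λ i j i<j → h (suc i) (suc j) (s<s i<j))

-- Stated for any transitive relation because it serves both positions and values.
increasing-triple : ∀ {A : Set} (_≺_ : A → A → Set) → Transitive _≺_ → (f : Fin 3 → A) →
                    f zero ≺ f (suc zero) → f (suc zero) ≺ f (suc (suc zero)) →
                    ∀ a b → a Fin.< b → f a ≺ f b
increasing-triple _≺_ tr f p q zero          (suc zero)       _ = p
increasing-triple _≺_ tr f p q zero          (suc (suc zero)) _ = tr p q
increasing-triple _≺_ tr f p q (suc zero)    (suc (suc zero)) _ = q
increasing-triple _≺_ tr f p q (suc zero)    (suc zero) (s<s ())
increasing-triple _≺_ tr f p q (suc (suc zero)) (suc zero) (s<s ())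
increasing-triple _≺_ tr f p q (suc (suc zero)) (suc (suc zero)) (s<s (s<s ()))

contains123 : ∀ τ {i j k} → i Fin.< j → j Fin.< k →
              lookup τ i < lookup τ j → lookup τ j < lookup τ k → Contains τ p123
contains123 τ {i} {j} {k} i<j j<k x<y y<z =
  f , increasing-triple Fin._<_ (λ {x} {y} {z} → Finₚ.<-trans {i = x} {y} {z}) f i<j j<k ,
  -- Both sides of the equivalence are true whenever `a` precedes `b`, so each is proved outright.
  λ a b a<b → mk⇔ (λ _ → increasing-triple _<_ <-trans (lookup p123) (n<1+n 1) (n<1+n 2) a b a<b)
                  (λ _ → increasing-triple _<_ <-trans (lookup τ ∘ f) x<y y<z a b a<b)
  where
  f : Fin 3 → Fin (length τ)
  f zero             = i
  f (suc zero)       = j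
  f (suc (suc zero)) = k

avoids⇒avoids123 : ∀ τ → Avoids τ p123 → Avoids123 τ
avoids⇒avoids123 τ av = go τ λ i j k i<j j<k x<y y<z → av (contains123 τ {i} {j} {k} i<j j<k x<y y<z)
  where
  go : ∀ τ → (∀ i j k → i Fin.< j → j Fin.< k → lookup τ i < lookup τ j → lookup τ j ≮ lookup τ k) →
       Avoids123 τ
  go []      h = []
  go (x ∷ τ) h =
    allPairs-tabulate τ (λ j k j<k → h zero (suc j) (suc k) z<s (s<s j<k)) ∷
    go τ (λ i j k i<j j<k → h (suc i) (suc j) (suc k) (s<s i<j) (s<s j<k))

avoids123⇒avoids : ∀ {τ} → Avoids123 τ → Avoids τ p123
avoids123⇒avoids {τ} av (f , f-mono , f-iff) =
  go av (f zero) (f (suc zero)) (f (suc (suc zero)))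
    (f-mono zero (suc zero) z<s) (f-mono (suc zero) (suc (suc zero)) (s<s z<s))
    (Equivalence.from (f-iff zero (suc zero) z<s) (n<1+n 1))
    (Equivalence.from (f-iff (suc zero) (suc (suc zero)) (s<s z<s)) (n<1+n 2))
  where
  go : ∀ {τ} → Avoids123 τ → ∀ i j k → i Fin.< j → j Fin.< k →
       lookup τ i < lookup τ j → lookup τ j ≮ lookup τ k
  go (noAscent ∷ _) zero    (suc j) (suc k) _         (s<s j<k) = allPairs-lookup noAscent j k j<k
  go (_ ∷ av)       (suc i) (suc j) (suc k) (s<s i<j) (s<s j<k) = go av i j k i<j j<k

-- Avoidance across the end of a prefix

NoAscentBelow : List ℕ → List ℕ → Set
NoAscentBelow w = AllPairs (λ y z → y < z → All (z ≮_) w)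

-- The four hypotheses exclude the patterns with three, none, two and one of their letters in `c`,
-- respectively.
avoids-++⁺ : ∀ {c w} → Avoids123 c → Avoids123 w → NoAscentBelow w c →
             All (λ x → NoAscentAbove x w) c → Avoids123 (c ++ w)
avoids-++⁺ []               avw _               _           = avw
avoids-++⁺ (noAscent ∷ avc) avw (below ∷ belows) (above ∷ aboves) =
  AllPairsₚ.++⁺ noAscent above (All.map (λ h → All.tabulate λ z∈w x<y → All.lookup (h x<y) z∈w) below) ∷
  avoids-++⁺ avc avw belows aboves

avoids-++⁻ : ∀ c {w} → Avoids123 (c ++ w) →
             Avoids123 w × NoAscentBelow w c × All (λ x → NoAscentAbove x w) c
avoids-++⁻ []      av              = av , [] , []
avoids-++⁻ (x ∷ c) (noAscent ∷ av) =
  let _ , above , cross = allPairs-++⁻ c noAscent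
      avw , belows , aboves = avoids-++⁻ c av
  in avw , All.map (λ h x<y → All.map (λ g → g x<y) h) cross ∷ belows , above ∷ aboves

++-cancelˡ-↭ : ∀ (c : List ℕ) {v w} → c ++ v ↭ c ++ w → v ↭ w
++-cancelˡ-↭ []      p = p
++-cancelˡ-↭ (x ∷ c) p = ++-cancelˡ-↭ c (drop-∷ p)

take-length-++ : ∀ (c w : List ℕ) → take (length c) (c ++ w) ≡ c
take-length-++ []      w = refl
take-length-++ (x ∷ c) w = cong (x ∷_) (take-length-++ c w)

prefix-split : ∀ (c τ : List ℕ) → take (length c) τ ≡ c → ∃[ w ] (τ ≡ c ++ w)
prefix-split c τ eq = drop (length c) τ , trans (sym (take++drop≡id (length c) τ)) (cong (_++ drop (length c) τ) eq)

-- Missing values and the count for a prefix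

interval-decreasing : ∀ n → Decreasing (applyDownFrom suc n)
interval-decreasing n = AllPairsₚ.applyDownFrom⁺₁ suc n λ j<i _ → s<s j<i

-- Every value below the minimum `suc l` is missing from `c`, so the lower part is the whole
-- interval; `U` collects the missing values above. Both are listed downwards, and
-- `applyDownFrom suc (suc l)` unfolds to the minimum followed by the lower part.
complement : ∀ {n c l} → suc l ∈ c → All (suc l ≤_) c → All (_∈ ⟦ n ⟧) c → Unique c →
  ∃[ U ] (let X = U ++ applyDownFrom suc l in
          Decreasing (U ++ applyDownFrom suc (suc l)) × c ++ X ↭ ⟦ n ⟧ × (∀ {α} → α ∈ X → α ∉ c))
complement {n} {c} {l} r∈c r≤c c⊆n c! = U , decreasing , perm , X∉c
  where
  r = suc l
  L = applyDownFrom suc l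
  P? = λ x → (r <? x) ×-dec ¬? (x ∈? c)
  U = filter P? (applyDownFrom suc n)

  U⁻ : ∀ {x} → x ∈ U → x ∈ applyDownFrom suc n × r < x × x ∉ c
  U⁻ = ∈-filter⁻ P? {xs = applyDownFrom suc n}

  decreasing : Decreasing (U ++ r ∷ L)
  decreasing = AllPairsₚ.++⁺ (AllPairsₚ.filter⁺ P? (interval-decreasing n)) (interval-decreasing r)
    (All.tabulate λ x∈U → let _ , r<x , _ = U⁻ x∈U in
      r<x ∷ All.map (λ y<r → <-trans y<r r<x) (AllPairs.head (interval-decreasing r)))

  X∉c : ∀ {α} → α ∈ U ++ L → α ∉ c
  X∉c α∈ α∈c with ∈-++⁻ U α∈
  ... | inj₁ α∈U = proj₂ (proj₂ (U⁻ α∈U)) α∈c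
  ... | inj₂ α∈L = <⇒≱ (All.lookup (AllPairs.head (interval-decreasing r)) α∈L) (All.lookup r≤c α∈c)

  l<n : l < n
  l<n with _ , i<n , refl ← ∈-applyUpTo⁻ suc (All.lookup c⊆n r∈c) = i<n

  to : ∀ {x} → x ∈ c ++ (U ++ L) → x ∈ ⟦ n ⟧
  to x∈ with ∈-++⁻ c x∈
  ... | inj₁ x∈c = All.lookup c⊆n x∈c
  ... | inj₂ x∈X with ∈-++⁻ U x∈X
  ...   | inj₁ x∈U with _ , i<n , refl ← ∈-applyDownFrom⁻ suc (proj₁ (U⁻ x∈U)) = ∈-applyUpTo⁺ suc i<n
  ...   | inj₂ x∈L with _ , i<l , refl ← ∈-applyDownFrom⁻ suc x∈L = ∈-applyUpTo⁺ suc (<-trans i<l l<n)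

  from : ∀ {x} → x ∈ ⟦ n ⟧ → x ∈ c ++ (U ++ L)
  from {x} x∈ with i , i<n , refl ← ∈-applyUpTo⁻ suc x∈ with x ∈? c | <-cmp i l
  ... | yes x∈c | _            = ∈-++⁺ˡ x∈c
  ... | no  x∉c | tri< i<l _ _ = ∈-++⁺ʳ c (∈-++⁺ʳ U (∈-applyDownFrom⁺ suc i<l))
  ... | no  x∉c | tri≈ _ refl _ = ⊥-elim (x∉c r∈c)
  ... | no  x∉c | tri> _ _ l<i =
    ∈-++⁺ʳ c (∈-++⁺ˡ (∈-filter⁺ P? (∈-applyDownFrom⁺ suc i<n) (s<s l<i , x∉c)))

  perm : c ++ (U ++ L) ↭ ⟦ n ⟧
  perm = ∼bag⇒↭ (unique∧set⇒bag
    (Uniqueₚ.++⁺ c! (AllPairs.map >⇒≢ (allPairs-drop-mid U decreasing)) λ (x∈c , x∈X) → X∉c x∈X x∈c)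
    (Uniqueₚ.applyUpTo⁺₁ suc n λ i<j _ → <⇒≢ (s<s i<j))
    (mk⇔ to from))

-- Appending to `c` is a bijection from the words for its minimum onto the set to be counted. The
-- size equation determines `u`, which makes different prefixes comparable.
prefix-count : ∀ {n c l} → suc l ∈ c → All (suc l ≤_) c → All (_∈ ⟦ n ⟧) c → Unique c →
  Avoids c p123 → ¬ AscentBelowMissing n c →
  ∃[ u ] (length c + (u + l) ≡ n × HasCard (S n c p123) (ballot l u))
prefix-count {n} {c} {l} r∈c r≤c c⊆n c! av ¬below
  with U , decreasing , perm , X∉c ← complement r∈c r≤c c⊆n c!
  = length U , size , HasCard-resp-⇔ (λ τ → mk⇔ to from)
      (HasCard-map (c ++_) (λ {v} {w} → ++-cancelˡ c v w)
        (subst (λ k → HasCard (Word U (suc l) L) (ballot k (length U))) (length-applyDownFrom suc l)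
          (word-count U (suc l) L decreasing)))
  where
  L = applyDownFrom suc l

  size : length c + (length U + l) ≡ n
  size = begin
    length c + (length U + l)          ≡⟨ cong (λ k → length c + (length U + k)) (length-applyDownFrom suc l) ⟨
    length c + (length U + length L)   ≡⟨ cong (length c +_) (length-++ U) ⟨
    length c + length (U ++ L)         ≡⟨ length-++ c ⟨
    length (c ++ (U ++ L))             ≡⟨ ↭-length perm ⟩
    length ⟦ n ⟧                       ≡⟨ length-applyUpTo suc n ⟩
    n                                  ∎

  noAscentBelow : NoAscentBelow (U ++ L) c
  noAscentBelow = allPairs-tabulate c λ i j i<j ci<cj → All.tabulate λ {α} α∈X cj<α →
    ¬below (i , j , i<j , ci<cj , α , ∈-resp-↭ perm (∈-++⁺ʳ c α∈X) , cj<α , X∉c α∈X)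

  to : ∀ {τ} → ∃[ w ] (Word U (suc l) L w × τ ≡ c ++ w) → S n c p123 τ
  to (w , (w↭ , noAscent ∷ avw) , refl) =
    ↭-trans (++⁺ˡ c w↭) perm , take-length-++ c w ,
    avoids123⇒avoids (avoids-++⁺ (avoids⇒avoids123 c av) avw
      (AllPairs.map (λ h y<z → All.tabulate λ α∈w → All.lookup (h y<z) (∈-resp-↭ w↭ α∈w)) noAscentBelow)
      (All.map (λ r≤x → noAscentAbove-mono r≤x noAscent) r≤c))

  from : ∀ {τ} → S n c p123 τ → ∃[ w ] (Word U (suc l) L w × τ ≡ c ++ w)
  from {τ} (τ↭ , take≡ , avτ) with w , refl ← prefix-split c τ take≡ =
    let avw , _ , above = avoids-++⁻ c (avoids⇒avoids123 τ avτ)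
    in w , (++-cancelˡ-↭ c (↭-trans τ↭ (↭-sym perm)) , All.lookup above r∈c ∷ avw) , refl

-- The missing value `α` must occur after the prefix, where it completes the ascent to a pattern.
ascentBelowMissing⇒∅ : ∀ {n c τ} → AscentBelowMissing n c → ¬ S n c p123 τ
ascentBelowMissing⇒∅ {c = c} {τ} (i , j , i<j , ci<cj , α , α∈n , cj<α , α∉c) (τ↭ , take≡ , av)
  with w , refl ← prefix-split c τ take≡
  with ∈-++⁻ c (∈-resp-↭ (↭-sym τ↭) α∈n)
... | inj₁ α∈c = α∉c α∈c
... | inj₂ α∈w =
  let _ , below , _ = avoids-++⁻ c (avoids⇒avoids123 τ av)
  in All.lookup (allPairs-lookup below i j i<j ci<cj) α∈w cj<α

-- Evaluation at the prefix minimum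

∈⟦⟧⇒≤ : ∀ {n x} → x ∈ ⟦ n ⟧ → x ≤ n
∈⟦⟧⇒≤ x∈ with _ , i<n , refl ← ∈-applyUpTo⁻ suc x∈ = i<n

minOf-∈ : ∀ {n c} → 1 ≤ length c → All (_∈ ⟦ n ⟧) c → minOf n c ∈ c
minOf-∈ {n} {x ∷ c} _ (x∈n ∷ _) with argmin-sel id n (x ∷ c)
... | inj₂ min∈  = min∈
-- If the default value `n` is the minimum, the first entry lies between `n` and `n`.
... | inj₁ min≡n = here (≤-antisym (All.head (min≤xs n (x ∷ c))) (subst (x ≤_) (sym min≡n) (∈⟦⟧⇒≤ x∈n)))

S-singleton⇔S₁ : ∀ {m r σ} τ → S m (r ∷ []) σ τ ⇔ S₁ m r σ τ
S-singleton⇔S₁ []      = mk⇔ (λ { (_ , () , _) }) (λ { (_ , () , _) })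
S-singleton⇔S₁ (x ∷ τ) = mk⇔ (λ (τ↭ , eq , av) → τ↭ , cong just (∷-injectiveˡ eq) , av)
                             (λ (τ↭ , eq , av) → τ↭ , cong (_∷ []) (just-injective eq) , av)

-- A one-letter prefix has no ascent, so the prefix count applies to it; its size equation forces
-- the number of upper values to be `u`.
S₁-count : ∀ l u → HasCard (S₁ (suc (l + u)) (suc l) p123) (ballot l u)
S₁-count l u
  with u′ , size , count ← prefix-count {suc (l + u)} {suc l ∷ []} {l}
         (here refl) (≤-refl ∷ []) (∈-applyUpTo⁺ suc (s≤s (m≤m+n l u)) ∷ []) ([] ∷ [])
         (avoids123⇒avoids ([] ∷ [])) (λ { (zero , zero , () , _) })
  with refl ← +-cancelˡ-≡ l u′ u (trans (+-comm l u′) (suc-injective size))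
  = HasCard-resp-⇔ S-singleton⇔S₁ count

-- The `n ∸ t` remaining values and the prefix minimum make `l + u + 1` values in all, among which
-- the minimum has rank `l + 1`.
S₁-count-formula : ∀ {n t r l u} → t + (u + l) ≡ n → r ≡ suc l →
                   HasCard (S₁ (n ∸ t + 1) r p123) (ballot l u) × ballot l u ÷ 1 ≡ b (n ∸ t + 1) r
S₁-count-formula {t = t} {l = l} {u} refl refl =
  subst (λ m → HasCard (S₁ m (suc l) p123) (ballot l u) × ballot l u ÷ 1 ≡ b m (suc l))
    (sym size) (S₁-count l u , ballot-b l u)
  where
  size : t + (u + l) ∸ t + 1 ≡ suc (l + u)
  size = trans (cong (_+ 1) (trans (m+n∸m≡n t (u + l)) (+-comm u l))) (+-comm (l + u) 1)

theorem4p4 : (n t : ℕ) (c : List ℕ) →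
    3 ≤ n → 1 ≤ t → t < n → length c ≡ t →
    All (_∈ ⟦ n ⟧) c → Unique c → Avoids c p123 →
    (AscentBelowMissing n c → HasCard (S n c p123) 0) ×
    (¬ AscentBelowMissing n c →
    ∃[ k ] (HasCard (S n c p123) k ×
    HasCard (S₁ (n ∸ t + 1) (minOf n c) p123) k ×
    k ÷ 1 ≡ b (n ∸ t + 1) (minOf n c)))
theorem4p4 n t c _ 1≤t _ refl c⊆n c! av = (λ below → HasCard-∅ λ τ → ascentBelowMissing⇒∅ below) , count
  where
  count : ¬ AscentBelowMissing n c →
          ∃[ k ] (HasCard (S n c p123) k ×
                  HasCard (S₁ (n ∸ t + 1) (minOf n c) p123) k ×
                  k ÷ 1 ≡ b (n ∸ t + 1) (minOf n c))
  count ¬below =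
    let min∈c = minOf-∈ 1≤t c⊆n
        -- As an element of the interval the minimum is a successor `suc l`, which makes `l` the
        -- number of values below it.
        l , _ , min≡ = ∈-applyUpTo⁻ suc (All.lookup c⊆n min∈c)
        u , size , S-count = prefix-count (subst (_∈ c) min≡ min∈c)
          (subst (λ r → All (r ≤_) c) min≡ (min≤xs n c)) c⊆n c! av ¬below
    in ballot l u , S-count , S₁-count-formula {n} {length c} {minOf n c} {l} {u} size min≡
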